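{- Let $s,t,q,N$ be integers with $0\le s<q$, $1\le t<q$, $N\ge0$, $t\nmid q$ and $\gcd(t,q)=g>1$. Put $\tilde t=t/g$, $\tilde q=q/g$, and write $s=\overline s g+s_g$ ($0\le s_g<g$), $\overline s=\overline{\overline s}\tilde t+\hat{\hat s}$ ($0\le\hat{\hat s}<\tilde t$), $\tilde q=\overline{\overline q}\tilde t+\hat{\hat q}$ ($1\le\hat{\hat q}<\tilde t$). Let $S^+(s,t,q,N)=\sum_{k=0}^N\lfloor(s+kt)/q\rfloor$, $M=\lfloor(s+Nt)/q\rfloor$, $x_M=(Mq-s)/t$, $S=\lfloor q/t\rfloor\frac{M(M-1)}2+M(N-\lceil x_M\rceil+1)$, $H=\{k\in\mathbb N:(\hat{\hat s}-k\hat{\hat q})\bmod\tilde t<\hat{\hat q}\}$, $J=H\cap\{0,\dots,\tilde t-1\}=\{j_0<\dots<j_{\hat{\hat q}-1}\}$, and $S_K=\sum_{k\in K}k$. Then: (a) if $j_0\ge M$, $S^+(s,t,q,N)=S$; (b.1) if $j_0<M\le j_{\hat{\hat q}-1}$, $S^+(s,t,q,N)=S+S_K$ with $K=H\cap\{0,\dots,M-1\}$; (b.2) if $j_{\hat{\hat q}-1}<M$ and $j_0+\tilde t\ge M$, $S^+(s,t,q,N)=S+S_J$; (b.3) if $j_{\hat{\hat q}-1}<M$ and $j_0+\tilde t<M$, with $u=\lfloor(M-1)/\tilde t\rfloor$ and $K=H\cap\{u\tilde t,\dots,M-1\}$, $S^+(s,t,q,N)=S+uS_J+\hat{\hat q}\,\tilde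 t\frac{(u-1)u}2+S_K$.
   Context: Here $r\bmod \tilde t$ denotes the representative of $r$ in $\{0,\dots,\tilde t-1\}$. -}

module Defs where

open import Data.Nat
  using (ℕ; zero; suc; _+_; _*_; _∸_; _/_; _%_; _≤_; _<_; _<?_; NonZero;
         >-nonZero; ≢-nonZero; ≢-nonZero⁻¹)
open import Data.Nat.Properties
open import Data.Nat.Divisibility using (_∣_; _∤_; *-monoˡ-∣; m%n≡0⇒n∣m)
open import Data.Nat.DivMod using (m%n<n; [m+kn]%n≡m%n; m<n⇒m%n≡m; m/n*n≡m)
open import Data.Nat.GCD using (gcd; gcd[m,n]∣m; gcd[m,n]∣n; gcd[m,n]≢0; m/gcd[m,n]≢0)
open import Data.Nat.ListAction using (sum)
open import Data.Nat.Solver using (module +-*-Solver)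
open import Data.Integer as ℤ using (ℤ; +_; -[1+_]; _/ℕ_; _%ℕ_)
import Data.Integer.DivMod as ℤ
import Data.Integer.Properties as ℤ
open import Data.Integer.Solver using () renaming (module +-*-Solver to ℤ-Solver)
open import Data.Rational as ℚ using (ℚ; ceiling)
open import Data.Fin using (Fin; fromℕ<; cast)
open import Data.List using (List; []; _∷_; [_]; _++_; filter; map; upTo; applyUpTo; length; lookup)
open import Data.List.Properties using (filter-++; filter-accept; filter-reject; length-++; upTo-∷ʳ)
open import Data.Product using (∃-syntax; _×_; _,_)
open import Data.Sum using (inj₂)
open import Function using (_∘_)
open import Level using (0ℓ)
open import Relation.Nullary using (yes; no)
open import Relation.Unary using (Pred; Decidable)
open import Relation.Binary.PropositionalEquality
  using (_≡_; refl; sym; trans; cong; cong₂; subst; subst₂; module ≡-Reasoning)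

open ≡-Reasoning

------------------------------------------------------------------------
-- The residue condition (a - k b) mod m < b holds for exactly b values
-- of k in {0, …, m - 1}.

module Residue (a b m : ℕ) .{{_ : NonZero m}} (a<m : a < m) (b<m : b < m) where

  -- _%ℕ_ returns the representative in {0, …, m - 1}, also when the
  -- difference is negative.
  H : Pred ℕ 0ℓ
  H k = ((+ a ℤ.- + k ℤ.* + b) %ℕ m) < b

  H? : Decidable H
  H? k = ((+ a ℤ.- + k ℤ.* + b) %ℕ m) <? b

  -- A residue is determined by its class.
  %-unique : ∀ {x y} c d → x < m → y < m → x + c * m ≡ y + d * m → x ≡ y
  %-unique {x} {y} c d x<m y<m eq = begin
    x                ≡⟨ m<n⇒m%n≡m x<m ⟨
    x % m            ≡⟨ [m+kn]%n≡m%n x c m ⟨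
    (x + c * m) % m  ≡⟨ cong (_% m) eq ⟩
    (y + d * m) % m  ≡⟨ [m+kn]%n≡m%n y d m ⟩
    y % m            ≡⟨ m<n⇒m%n≡m y<m ⟩
    y                ∎

  clear : ∀ r c k (z : ℤ) → a + c * m ≡ r + k * b →
          + a ℤ.- + k ℤ.* + b ≡ z → + r ≡ z ℤ.+ + (c * m)
  clear r c k z eq refl = begin
    + r
      ≡⟨ solve 2 (λ x y → x := x :+ y :- y) refl (+ r) (+ k ℤ.* + b) ⟩
    (+ r ℤ.+ + k ℤ.* + b) ℤ.- + k ℤ.* + b
      ≡⟨ cong (λ w → (+ r ℤ.+ w) ℤ.- + k ℤ.* + b) (ℤ.pos-* k b) ⟨
    + (r + k * b) ℤ.- + k ℤ.* + b                    ≡⟨ cong (λ w → + w ℤ.- + k ℤ.* + b) eq ⟨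
    (+ a ℤ.+ + (c * m)) ℤ.- + k ℤ.* + b
      ≡⟨ solve 3 (λ x y w → x :+ y :- w := x :- w :+ y) refl (+ a) (+ (c * m)) (+ k ℤ.* + b) ⟩
    (+ a ℤ.- + k ℤ.* + b) ℤ.+ + (c * m)              ∎
    where
    open ℤ-Solver

  residue : ∀ r c k → r < m → a + c * m ≡ r + k * b → (+ a ℤ.- + k ℤ.* + b) %ℕ m ≡ r
  residue r c k r<m eq = go (z /ℕ m) refl
    where
    z = + a ℤ.- + k ℤ.* + b
    ρ = z %ℕ m
    ρ<m : ρ < m
    ρ<m = ℤ.n%ℕd<d z m
    z≡ : z ≡ + ρ ℤ.+ (z /ℕ m) ℤ.* + m
    z≡ = ℤ.a≡a%ℕn+[a/ℕn]*n z m
    go : ∀ y → z /ℕ m ≡ y → ρ ≡ r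
    go (+ n) e = sym (%-unique 0 (n + c) r<m ρ<m (ℤ.+-injective (begin
      + (r + 0)                              ≡⟨ cong +_ (+-identityʳ r) ⟩
      + r
        ≡⟨ clear r c k _ eq (trans z≡ (cong (λ y → + ρ ℤ.+ y ℤ.* + m) e)) ⟩
      + ρ ℤ.+ + n ℤ.* + m ℤ.+ + (c * m)
        ≡⟨ cong (λ w → + ρ ℤ.+ w ℤ.+ + (c * m)) (ℤ.pos-* n m) ⟨
      + (ρ + n * m + c * m)
        ≡⟨ cong +_ (solve 4 (λ ρ n m c → ρ :+ n :* m :+ c :* m := ρ :+ (n :+ c) :* m) refl ρ n m c) ⟩
      + (ρ + (n + c) * m)                    ∎)))
      where
      open +-*-Solver
    go -[1+ n ] e = sym (%-unique (suc n) c r<m ρ<m (ℤ.+-injective (begin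
      + r ℤ.+ + (suc n * m)
        ≡⟨ cong (ℤ._+ + (suc n * m)) (clear r c k _ eq (trans z≡ (cong (λ y → + ρ ℤ.+ y ℤ.* + m) e))) ⟩
      + ρ ℤ.+ -[1+ n ] ℤ.* + m ℤ.+ + (c * m) ℤ.+ + (suc n * m)
        ≡⟨ cong (λ w → + ρ ℤ.+ w ℤ.+ + (c * m) ℤ.+ + (suc n * m))
             (trans (sym (ℤ.neg-distribˡ-* (+ suc n) (+ m))) (cong ℤ.-_ (sym (ℤ.pos-* (suc n) m)))) ⟩
      + ρ ℤ.- + (suc n * m) ℤ.+ + (c * m) ℤ.+ + (suc n * m)
        ≡⟨ solve 3 (λ ρ x y → ρ :- x :+ y :+ x := ρ :+ y) refl (+ ρ) (+ (suc n * m)) (+ (c * m)) ⟩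
      + ρ ℤ.+ + (c * m)                                             ∎)))
      where
      open ℤ-Solver

  count : ℕ → ℕ
  count n = length (filter H? (upTo n))

  count-suc : ∀ n → count (suc n) ≡ count n + length (filter H? [ n ])
  count-suc n = begin
    length (filter H? (upTo (suc n)))              ≡⟨ cong (length ∘ filter H?) (upTo-∷ʳ n) ⟨
    length (filter H? (upTo n ++ [ n ]))           ≡⟨ cong length (filter-++ H? (upTo n) [ n ]) ⟩
    length (filter H? (upTo n) ++ filter H? [ n ]) ≡⟨ length-++ (filter H? (upTo n)) ⟩
    count n + length (filter H? [ n ])             ∎

  -- Each step k ↦ k + 1 subtracts b from the residue, wrapping around
  -- exactly when k satisfies H.
  invariant : ∀ n → ∃[ r ] r < m × a + count n * m ≡ r + n * b
  invariant zero = a , a<m , refl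
  invariant (suc n) with invariant n
  ... | r , r<m , eq with H? n
  ... | yes h = (r + m) ∸ b , r′<m , (begin
      a + count (suc n) * m
        ≡⟨ cong (λ c → a + c * m)
             (trans (count-suc n) (cong (λ l → count n + length l) (filter-accept H? {xs = []} h))) ⟩
      a + (count n + 1) * m
        ≡⟨ solve 3 (λ a c m → a :+ (c :+ con 1) :* m := (a :+ c :* m) :+ m) refl a (count n) m ⟩
      (a + count n * m) + m      ≡⟨ cong (_+ m) eq ⟩
      (r + n * b) + m
        ≡⟨ solve 3 (λ r m x → (r :+ x) :+ m := (r :+ m) :+ x) refl r m (n * b) ⟩
      (r + m) + n * b            ≡⟨ cong (_+ n * b) (m∸n+n≡m b≤r+m) ⟨
      ((r + m) ∸ b + b) + n * b  ≡⟨ +-assoc ((r + m) ∸ b) b (n * b) ⟩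
      (r + m) ∸ b + (b + n * b)  ∎)
      where
      open +-*-Solver
      r<b : r < b
      r<b = subst (_< b) (residue r (count n) n r<m eq) h
      b≤r+m : b ≤ r + m
      b≤r+m = ≤-trans (<⇒≤ b<m) (m≤n+m m r)
      r′<m : (r + m) ∸ b < m
      r′<m = +-cancelʳ-< b _ _ (subst₂ _<_ (sym (m∸n+n≡m b≤r+m)) (+-comm b m) (+-monoˡ-< m r<b))
  ... | no ¬h = r ∸ b , ≤-<-trans (m∸n≤m r b) r<m , (begin
      a + count (suc n) * m
        ≡⟨ cong (λ c → a + c * m)
             (trans (count-suc n) (trans (cong (λ l → count n + length l) (filter-reject H? {xs = []} ¬h)) (+-identityʳ _))) ⟩
      a + count n * m        ≡⟨ eq ⟩
      r + n * b              ≡⟨ cong (_+ n * b) (m∸n+n≡m b≤r) ⟨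
      (r ∸ b + b) + n * b    ≡⟨ +-assoc (r ∸ b) b (n * b) ⟩
      r ∸ b + (b + n * b)    ∎)
      where
      b≤r : b ≤ r
      b≤r = ≮⇒≥ (¬h ∘ subst (_< b) (sym (residue r (count n) n r<m eq)))

  length-residues : length (filter H? (upTo m)) ≡ b
  length-residues with invariant m
  ... | r , r<m , eq = *-cancelʳ-≡ _ _ m (+-cancelˡ-≡ a _ _ (begin
      a + count m * m  ≡⟨ eq ⟩
      r + m * b        ≡⟨ cong₂ _+_ (sym a≡r) (*-comm m b) ⟩
      a + b * m        ∎))
      where
      a≡r : a ≡ r
      a≡r = %-unique (count m) b a<m r<m (trans eq (cong (_+_ r) (*-comm m b)))

------------------------------------------------------------------------

S⁺ : (s t q N : ℕ) .{{_ : NonZero q}} → ℕ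
S⁺ s t q N = sum (map (λ k → (s + k * t) / q) (upTo (suc N)))

module Setup (s t q N : ℕ) (1≤t : 1 ≤ t) (t<q : t < q) (t∤q : t ∤ q) where

  instance
    t≢0 : NonZero t
    t≢0 = >-nonZero 1≤t

    q≢0 : NonZero q
    q≢0 = >-nonZero (<-trans 1≤t t<q)

  g : ℕ
  g = gcd t q

  instance
    g≢0 : NonZero g
    g≢0 = ≢-nonZero (gcd[m,n]≢0 t q (inj₂ (≢-nonZero⁻¹ q)))

  t̃ q̃ : ℕ
  t̃ = t / g
  q̃ = q / g

  instance
    t̃≢0 : NonZero t̃
    t̃≢0 = ≢-nonZero (m/gcd[m,n]≢0 t q)

  s̄ : ℕ
  s̄ = s / g

  ŝ q̂ : ℕ
  ŝ = s̄ % t̃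
  q̂ = q̃ % t̃

  1≤q̂ : 1 ≤ q̂
  1≤q̂ = n≢0⇒n>0 λ q̂≡0 → t∤q (subst₂ _∣_
    (m/n*n≡m (gcd[m,n]∣m t q)) (m/n*n≡m (gcd[m,n]∣n t q))
    (*-monoˡ-∣ g (m%n≡0⇒n∣m q̃ t̃ q̂≡0)))

  M : ℕ
  M = (s + N * t) / q

  -- May be negative when M = 0.
  x-M : ℚ
  x-M = (+ (M * q) ℤ.- + s) ℚ./ t

  -- The division by 2 is exact: M (M - 1) is even.
  S : ℤ
  S = + (q / t) ℤ.* ((+ M ℤ.* (+ M ℤ.- + 1)) /ℕ 2)
      ℤ.+ + M ℤ.* (+ N ℤ.- ceiling x-M ℤ.+ + 1)

  open Residue ŝ q̂ t̃ (m%n<n s̄ t̃) (m%n<n q̃ t̃) public using (H; H?; length-residues)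

  -- H ∩ {a, …, b - 1}, listed in increasing order.
  H∩[_,_⟩ : ℕ → ℕ → List ℕ
  H∩[ a , b ⟩ = filter H? (applyUpTo (_+_ a) (b ∸ a))

  J : List ℕ
  J = H∩[ 0 , t̃ ⟩

  j : Fin q̂ → ℕ
  j i = lookup J (cast (sym length-residues) i)

  j-first j-last : ℕ
  j-first = j (fromℕ< {0} 1≤q̂)
  j-last  = j (fromℕ< {q̂ ∸ 1} (∸-monoʳ-< (n<1+n 0) 1≤q̂))

  -- Only used when M ≥ 1.
  u : ℕ
  u = (M ∸ 1) / t̃

{-# OPTIONS --safe #-}
module Submission where

-- Write h for the quotient of s̄ by t̃.  The column {n : ⌊(s + n t)/q⌋ ≥ m}
-- starts at n = ⌈(m q - s)/t⌉ = c m - h, where c m = m ⌊q/t⌋ + |H ∩ {0, …, m - 1}|.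
-- Counting the lattice points under the line by columns and then summing by
-- parts expresses S⁺ through c M and the increments c (k + 1) - c k, each of
-- which is ⌊q/t⌋ or, exactly for k ∈ H, ⌊q/t⌋ + 1.  Hence S⁺ is S plus the sum
-- of H ∩ {0, …, M - 1}; the cases evaluate this sum using that H is
-- periodic modulo t̃.

open import Defs
open import Data.Nat using (ℕ; zero; suc; _+_; _*_; _∸_; _/_; _%_; _≤_; _<_; _≥_; _>_; z≤n; s≤s⁻¹;
         NonZero; ≢-nonZero⁻¹)
open import Data.Nat.Properties
open import Data.Nat.Divisibility using (_∤_)
open import Data.Nat.DivMod
open import Data.Nat.GCD using (gcd; gcd[m,n]∣m; gcd[m,n]∣n; gcd[m,n]≢0)
open import Data.Nat.ListAction using (sum)
open import Data.Nat.ListAction.Properties using (sum-++)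
open import Data.Nat.Solver using (module +-*-Solver)
open import Data.Integer as ℤ using (+_; _/ℕ_)
import Data.Integer.DivMod as ℤ
import Data.Integer.GCD as ℤ
import Data.Integer.Properties as ℤ
open import Data.Integer.Solver using () renaming (module +-*-Solver to ℤ-Solver)
open import Data.Rational as ℚ using (ceiling; floor; ↥_; ↧_; ↧ₙ_)
import Data.Rational.Properties as ℚ
open import Data.Fin using (toℕ; cast)
open import Data.Fin.Properties using (toℕ<n; toℕ-fromℕ<; toℕ-cast)
open import Data.List using ([]; _∷_; [_]; _++_; filter; map; upTo; applyUpTo; length; lookup)
open import Data.List.Properties
  using (applyUpTo-∷ʳ; map-upTo; filter-accept; filter-reject; filter-none; filter-++)
open import Data.List.Membership.Propositional.Properties
  using (∈-upTo⁺; ∈-upTo⁻; ∈-filter⁺; ∈-filter⁻; ∈-lookup)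
open import Data.List.Relation.Unary.All.Properties using (applyUpTo⁺₁)
open import Data.List.Relation.Unary.Any.Properties using (lookup-index)
open import Data.List.Relation.Unary.Sorted.TotalOrder ≤-totalOrder using (Sorted)
import Data.List.Relation.Unary.Sorted.TotalOrder.Properties as Sorted
open import Data.Product using (∃-syntax; _×_; _,_; proj₁; proj₂)
open import Data.Sum using (inj₁; inj₂; [_,_]′)
open import Algebra.Properties.CommutativeSemigroup +-commutativeSemigroup using (x∙yz≈y∙xz)
open import Function using (_∘_; id)
open import Level using (0ℓ)
open import Relation.Nullary using (¬_; yes; no)
open import Relation.Unary using (Pred; Decidable)
open import Relation.Binary.PropositionalEquality
  using (_≡_; refl; sym; trans; cong; cong₂; subst; subst₂; module ≡-Reasoning)

-- Floors and ceilings of fractions, determined by their two bounds.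

/ℕ-unique : ∀ x d .{{_ : NonZero d}} f → f ℤ.* + d ℤ.≤ x → x ℤ.< ℤ.suc f ℤ.* + d → x /ℕ d ≡ f
/ℕ-unique x d f lo hi = ℤ.≤-antisym
  (bound (ℤ.≤-<-trans (ℤ.[n/ℕd]*d≤n x d) hi))
  (bound (ℤ.≤-<-trans lo (ℤ.n<s[n/ℕd]*d x d)))
  where
  bound : ∀ {i j} → i ℤ.* + d ℤ.< ℤ.suc j ℤ.* + d → i ℤ.≤ j
  bound {i} {j} lt = subst₂ ℤ._≤_ (ℤ.pred-suc i) (ℤ.pred-suc j)
    (ℤ.pred-mono (ℤ.i<j⇒suc[i]≤j (ℤ.*-cancelʳ-<-nonNeg {i} {ℤ.suc j} (+ d) lt)))

floor-unique : ∀ p f → f ℤ.* ↧ p ℤ.≤ ↥ p → ↥ p ℤ.< ℤ.suc f ℤ.* ↧ p → floor p ≡ f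
floor-unique p@record{} f lo hi =
  trans (ℤ.div-pos-is-/ℕ (↥ p) (↧ₙ p)) (/ℕ-unique (↥ p) (↧ₙ p) f lo hi)

-- `ceiling` is the negated `floor` of the negation, so the two bounds are negated and exchange
-- roles.
ceiling-unique : ∀ p c → ℤ.pred c ℤ.* ↧ p ℤ.< ↥ p → ↥ p ℤ.≤ c ℤ.* ↧ p → ceiling p ≡ c
ceiling-unique p@record{} c lo hi = trans
  (cong ℤ.-_ (floor-unique (ℚ.- p) (ℤ.- c)
    (subst₂ ℤ._≤_ (neg-* c) (sym (ℚ.↥-neg p)) (ℤ.neg-mono-≤ hi))
    (subst₂ ℤ._<_ (sym (ℚ.↥-neg p))
      (trans (neg-* (ℤ.pred c)) (cong (ℤ._* ↧ (ℚ.- p)) (ℤ.neg-distrib-+ (ℤ.- + 1) c)))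
      (ℤ.neg-mono-< lo))))
  (ℤ.neg-involutive c)
  where
  neg-* : ∀ x → ℤ.- (x ℤ.* ↧ p) ≡ ℤ.- x ℤ.* ↧ (ℚ.- p)
  neg-* x = trans (ℤ.neg-distribˡ-* x (↧ p)) (cong (ℤ.- x ℤ.*_) (sym (ℚ.↧-neg p)))

-- `i ℚ./ t` is kept in lowest terms. Multiplying its numerator and denominator by the gcd of `i`
-- and `t` restores `i` and `t`; this gcd is positive, so it cancels from both bounds.
ceiling-/ : ∀ i t .{{_ : NonZero t}} c → ℤ.pred c ℤ.* + t ℤ.< i → i ℤ.≤ c ℤ.* + t →
            ceiling (i ℚ./ t) ≡ c
ceiling-/ i t c lo hi = ceiling-unique (i ℚ./ t) c
  (ℤ.*-cancelʳ-<-nonNeg G (subst₂ ℤ._<_ (scale (ℤ.pred c)) (sym (ℚ.↥-/ i t)) lo))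
  (ℤ.*-cancelʳ-≤-pos _ _ G (subst₂ ℤ._≤_ (sym (ℚ.↥-/ i t)) (scale c) hi))
  where
  G = ℤ.gcd i (+ t)
  instance
    G>0 : ℤ.Positive G
    G>0 = ℤ.positive (ℤ.+<+ (n≢0⇒n>0 (gcd[m,n]≢0 ℤ.∣ i ∣ t (inj₂ (≢-nonZero⁻¹ t)))))
  scale : ∀ x → x ℤ.* + t ≡ x ℤ.* ↧ (i ℚ./ t) ℤ.* G
  scale x = trans (cong (x ℤ.*_) (sym (ℚ.↧-/ i t))) (sym (ℤ.*-assoc x (↧ (i ℚ./ t)) G))

-- Inequalities locating the start of a column.

module _ where
  open ≤-Reasoning
  open +-*-Solver

  -- For `R < t`, `eq` says that `c - h` is the ceiling of `(mq - s) / t`. The lemmas compare `c`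
  -- with `n + h` because `c - h` can be negative.
  module _ (s t R c h mq : ℕ) (eq : s + c * t ≡ R + mq + h * t) where

    mq≤s+nt⇒c≤n+h : R < t → ∀ n → mq ≤ s + n * t → c ≤ n + h
    -- Proved as `c < suc (n + h)`: the extra multiple of `t` absorbs `R < t`.
    mq≤s+nt⇒c≤n+h R<t n mq≤ = s≤s⁻¹ (*-cancelʳ-< t _ _ (+-cancelˡ-< s _ _ (begin-strict
      s + c * t                       ≡⟨ eq ⟩
      R + mq + h * t                  <⟨ +-monoˡ-< (h * t) (+-mono-<-≤ R<t mq≤) ⟩
      t + (s + n * t) + h * t
        ≡⟨ solve 4 (λ t s n h → t :+ (s :+ n :* t) :+ h :* t := s :+ (con 1 :+ n :+ h) :* t) refl t s n h ⟩
      s + suc (n + h) * t             ∎)))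

    c≤n+h⇒mq≤s+nt : ∀ n → c ≤ n + h → mq ≤ s + n * t
    c≤n+h⇒mq≤s+nt n c≤ = +-cancelʳ-≤ (h * t) _ _ (begin
      mq + h * t               ≤⟨ +-monoˡ-≤ (h * t) (m≤n+m mq R) ⟩
      R + mq + h * t           ≡⟨ eq ⟨
      s + c * t                ≤⟨ +-monoʳ-≤ s (*-monoˡ-≤ t c≤) ⟩
      s + (n + h) * t          ≡⟨ solve 4 (λ s n h t → s :+ (n :+ h) :* t := s :+ n :* t :+ h :* t) refl s n h t ⟩
      s + n * t + h * t        ∎)

  [m+n]/o≤1+n/o : ∀ m n o .{{_ : NonZero o}} → m ≤ o → (m + n) / o ≤ suc (n / o)
  [m+n]/o≤1+n/o m n o m≤o = begin
    (m + n) / o          ≤⟨ /-monoˡ-≤ o (+-monoˡ-≤ n m≤o) ⟩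
    (o + n) / o          ≡⟨ m/n≡1+[m∸n]/n (m≤m+n o n) ⟩
    suc ((o + n ∸ o) / o) ≡⟨ cong (λ x → suc (x / o)) (m+n∸m≡n o n) ⟩
    suc (n / o)          ∎

open ≡-Reasoning

-- Finite sums, summation by parts and double counting.

applyUpTo-+ : ∀ {A : Set} (f : ℕ → A) m n →
              applyUpTo f (m + n) ≡ applyUpTo f m ++ applyUpTo (f ∘ (_+_ m)) n
applyUpTo-+ f zero    n = refl
applyUpTo-+ f (suc m) n = cong (f 0 ∷_) (applyUpTo-+ (f ∘ suc) m n)

sum-applyUpTo-suc : ∀ f n → sum (applyUpTo f (suc n)) ≡ sum (applyUpTo f n) + f n
sum-applyUpTo-suc f n = begin
  sum (applyUpTo f (suc n))         ≡⟨ cong sum (applyUpTo-∷ʳ f n) ⟨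
  sum (applyUpTo f n ++ [ f n ])    ≡⟨ sum-++ (applyUpTo f n) [ f n ] ⟩
  sum (applyUpTo f n) + (f n + 0)   ≡⟨ cong (λ w → sum (applyUpTo f n) + w) (+-identityʳ (f n)) ⟩
  sum (applyUpTo f n) + f n         ∎

sum-map-+ : ∀ x ns → sum (map (_+_ x) ns) ≡ sum ns + length ns * x
sum-map-+ x []       = refl
sum-map-+ x (n ∷ ns) = begin
  x + n + sum (map (_+_ x) ns)          ≡⟨ cong (λ w → x + n + w) (sum-map-+ x ns) ⟩
  x + n + (sum ns + length ns * x)     ≡⟨ solve 4 (λ x n a b → x :+ n :+ (a :+ b) := n :+ a :+ (x :+ b)) refl x n (sum ns) (length ns * x) ⟩
  n + sum ns + (x + length ns * x)     ∎
  where open +-*-Solver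

-- The formula for triangular numbers, cleared of division and subtraction; it shows below that the
-- halving is exact.
sum-upTo : ∀ n → sum (upTo n) * 2 + n ≡ n * n
sum-upTo zero    = refl
sum-upTo (suc n) = begin
  sum (upTo (suc n)) * 2 + suc n       ≡⟨ cong (λ x → x * 2 + suc n) (sum-applyUpTo-suc id n) ⟩
  (sum (upTo n) + n) * 2 + suc n
    ≡⟨ solve 2 (λ x n → (x :+ n) :* con 2 :+ (con 1 :+ n) := (x :* con 2 :+ n) :+ con 2 :* n :+ con 1) refl (sum (upTo n)) n ⟩
  (sum (upTo n) * 2 + n) + 2 * n + 1   ≡⟨ cong (λ x → x + 2 * n + 1) (sum-upTo n) ⟩
  n * n + 2 * n + 1
    ≡⟨ solve 1 (λ n → n :* n :+ con 2 :* n :+ con 1 := (con 1 :+ n) :* (con 1 :+ n)) refl n ⟩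
  suc n * suc n                        ∎
  where open +-*-Solver

[n[n-1]]/2≡sum-upTo : ∀ n → (+ n ℤ.* (+ n ℤ.- + 1)) /ℕ 2 ≡ + sum (upTo n)
[n[n-1]]/2≡sum-upTo n = begin
  (+ n ℤ.* (+ n ℤ.- + 1)) /ℕ 2   ≡⟨ cong (_/ℕ 2) twice ⟩
  + (sum (upTo n) * 2) /ℕ 2      ≡⟨ cong +_ (m*n/n≡m (sum (upTo n)) 2) ⟩
  + sum (upTo n)                 ∎
  where
  open ℤ-Solver
  twice : + n ℤ.* (+ n ℤ.- + 1) ≡ + (sum (upTo n) * 2)
  twice = begin
    + n ℤ.* (+ n ℤ.- + 1)
      ≡⟨ solve 1 (λ n → n :* (n :- con (+ 1)) := n :* n :- n) refl (+ n) ⟩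
    + n ℤ.* + n ℤ.- + n                     ≡⟨ cong (ℤ._- + n) (ℤ.pos-* n n) ⟨
    + (n * n) ℤ.- + n                       ≡⟨ cong (λ x → + x ℤ.- + n) (sum-upTo n) ⟨
    + (sum (upTo n) * 2) ℤ.+ + n ℤ.- + n
      ≡⟨ solve 2 (λ x y → x :+ y :- y := x) refl (+ (sum (upTo n) * 2)) (+ n) ⟩
    + (sum (upTo n) * 2)                    ∎

-- Among `c 1`, ..., `c n`, exactly the first `k` terms still lack the increment `d k` that `c n`
-- contains, so the second sum is their total shortfall from `c n`.
abel-summation : ∀ (c d : ℕ → ℕ) → (∀ k → c (suc k) ≡ c k + d k) → ∀ n →
  sum (applyUpTo (c ∘ suc) n) + sum (applyUpTo (λ k → k * d k) n) ≡ n * c n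
abel-summation c d step zero    = refl
abel-summation c d step (suc n) = begin
  sum (applyUpTo (c ∘ suc) (suc n)) + sum (applyUpTo (λ k → k * d k) (suc n))
    ≡⟨ cong₂ _+_ (sum-applyUpTo-suc (c ∘ suc) n) (sum-applyUpTo-suc (λ k → k * d k) n) ⟩
  (x + c (suc n)) + (y + n * d n)
    ≡⟨ solve 4 (λ x z y w → (x :+ z) :+ (y :+ w) := z :+ (x :+ y :+ w)) refl x (c (suc n)) y (n * d n) ⟩
  c (suc n) + (x + y + n * d n)      ≡⟨ cong (λ w → c (suc n) + (w + n * d n)) (abel-summation c d step n) ⟩
  c (suc n) + (n * c n + n * d n)    ≡⟨ cong (λ w → c (suc n) + w) (*-distribˡ-+ n (c n) (d n)) ⟨
  c (suc n) + n * (c n + d n)        ≡⟨ cong (λ w → c (suc n) + n * w) (step n) ⟨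
  suc n * c (suc n)                  ∎
  where
  open +-*-Solver
  x = sum (applyUpTo (c ∘ suc) n)
  y = sum (applyUpTo (λ k → k * d k) n)

-- Counts the pairs (n , m) with 1 ≤ m ≤ f n; column m starts at n = c m - h.
module _ (f c : ℕ → ℕ) (h : ℕ) (f0≡0 : f 0 ≡ 0)
         (f-mono : ∀ n → f n ≤ f (suc n)) (f-step : ∀ n → f (suc n) ≤ suc (f n))
         (to : ∀ m n → m ≤ f n → c m ≤ n + h) (from : ∀ m n → c m ≤ n + h → m ≤ f n) where

  double-counting : ∀ n → sum (applyUpTo f (suc n)) + sum (applyUpTo (c ∘ suc) (f n)) ≡ f n * (suc n + h)
  -- `f 0 = 0` means that every column starts after `n = 0`, so none is cut off at the left edge.
  double-counting zero rewrite f0≡0 = refl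
  double-counting (suc n) = begin
    sum (applyUpTo f (2 + n)) + γ (f (suc n))  ≡⟨ cong (_+ γ (f (suc n))) (sum-applyUpTo-suc f (suc n)) ⟩
    φ + f (suc n) + γ (f (suc n))              ≡⟨ case ⟩
    f (suc n) * (2 + n + h)                    ∎
    where
    open +-*-Solver
    φ = sum (applyUpTo f (suc n))
    γ = λ m → sum (applyUpTo (c ∘ suc) m)
    case : φ + f (suc n) + γ (f (suc n)) ≡ f (suc n) * (2 + n + h)
    case with m≤n⇒m<n∨m≡n (f-mono n)
    -- No column starts at `suc n`; each of the `f n` existing ones gains one point.
    ... | inj₂ eq rewrite sym eq = begin
      φ + f n + γ (f n)         ≡⟨ solve 3 (λ x y z → x :+ y :+ z := y :+ (x :+ z)) refl φ (f n) (γ (f n)) ⟩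
      f n + (φ + γ (f n))       ≡⟨ cong (λ w → f n + w) (double-counting n) ⟩
      f n + f n * (suc n + h)   ≡⟨ *-suc (f n) (suc n + h) ⟨
      f n * (2 + n + h)         ∎
    -- Exactly one column is new, and it starts at `suc n`.
    ... | inj₁ lt rewrite ≤-antisym (f-step n) lt = begin
      φ + suc (f n) + γ (suc (f n))               ≡⟨ cong (λ w → φ + suc (f n) + w) (sum-applyUpTo-suc (c ∘ suc) (f n)) ⟩
      φ + suc (f n) + (γ (f n) + c (suc (f n)))   ≡⟨ cong (λ w → φ + suc (f n) + (γ (f n) + w)) c≡ ⟩
      φ + suc (f n) + (γ (f n) + (suc n + h))
        ≡⟨ solve 4 (λ x y z w → x :+ y :+ (z :+ w) := y :+ w :+ (x :+ z)) refl φ (suc (f n)) (γ (f n)) (suc n + h) ⟩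
      suc (f n) + (suc n + h) + (φ + γ (f n))     ≡⟨ cong (λ w → suc (f n) + (suc n + h) + w) (double-counting n) ⟩
      suc (f n) + (suc n + h) + f n * (suc n + h)
        ≡⟨ solve 2 (λ x y → con 1 :+ x :+ y :+ x :* y := (con 1 :+ x) :* (con 1 :+ y)) refl (f n) (suc n + h) ⟩
      suc (f n) * (2 + n + h)                     ∎
      where
      c≡ : c (suc (f n)) ≡ suc n + h
      -- The new column is present at `suc n`, which bounds its start above by `to`; it is absent at
      -- `n`, which bounds it below by `from`.
      c≡ = ≤-antisym (to _ (suc n) lt) (≰⇒> (<⇒≱ (n<1+n (f n)) ∘ from (suc (f n)) n))

-- The residue set `H`: periodicity and partial sums.

filter-map : ∀ {A B : Set} {P : Pred B 0ℓ} {Q : Pred A 0ℓ} (P? : Decidable P) (Q? : Decidable Q) (f : A → B) →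
  (∀ {x} → Q x → P (f x)) → (∀ {x} → P (f x) → Q x) → ∀ xs → filter P? (map f xs) ≡ map f (filter Q? xs)
filter-map P? Q? f to from []       = refl
filter-map P? Q? f to from (x ∷ xs) with Q? x
... | yes q = trans (filter-accept P? (to q)) (cong (f x ∷_) (filter-map P? Q? f to from xs))
... | no ¬q = trans (filter-reject P? (¬q ∘ from)) (filter-map P? Q? f to from xs)

-- `length (filter P? [ n ])` serves as the 0-1 indicator of `P` at `n`, the form in which
-- `count-suc` supplies it.
sum-filter-[_] : ∀ n {P : Pred ℕ 0ℓ} (P? : Decidable P) → sum (filter P? [ n ]) ≡ n * length (filter P? [ n ])
sum-filter-[ n ] P? with P? n
... | yes _ = trans (+-identityʳ n) (sym (*-identityʳ n))
... | no  _ = sym (*-zeroʳ n)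

module ResidueProperties (a b m : ℕ) .{{_ : NonZero m}} (a<m : a < m) (b<m : b < m) where
  open Residue a b m a<m b<m

  -- Raising `k` by `c * m` changes the dividend by a multiple of `m`. Adding `c * m * b` to both
  -- sides of the equation from `invariant k` exhibits the same `r` as the residue in both places.
  H-periodic : ∀ c k → (+ a ℤ.- + (c * m + k) ℤ.* + b) ℤ.%ℕ m ≡ (+ a ℤ.- + k ℤ.* + b) ℤ.%ℕ m
  H-periodic c k with invariant k
  ... | r , r<m , eq = trans (residue r (count k + c * b) (c * m + k) r<m (begin
      a + (count k + c * b) * m    ≡⟨ solve 5 (λ a n c b m → a :+ (n :+ c :* b) :* m := (a :+ n :* m) :+ c :* m :* b) refl a (count k) c b m ⟩
      a + count k * m + c * m * b  ≡⟨ cong (_+ c * m * b) eq ⟩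
      r + k * b + c * m * b        ≡⟨ solve 4 (λ r k b x → r :+ k :* b :+ x :* b := r :+ (x :+ k) :* b) refl r k b (c * m) ⟩
      r + (c * m + k) * b          ∎))
    (sym (residue r (count k) k r<m eq))
    where open +-*-Solver

  filter-shift : ∀ c n → filter H? (applyUpTo (_+_ (c * m)) n) ≡ map (_+_ (c * m)) (filter H? (upTo n))
  filter-shift c n = trans (cong (filter H?) (sym (map-upTo (_+_ (c * m)) n)))
    (filter-map H? H? (_+_ (c * m)) (λ {k} → subst (_< b) (sym (H-periodic c k)))
                                 (λ {k} → subst (_< b) (H-periodic c k)) (upTo n))

  σ : ℕ → ℕ
  σ n = sum (filter H? (upTo n))

  σ-+ : ∀ k n → σ (k + n) ≡ σ k + sum (filter H? (applyUpTo (_+_ k) n))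
  σ-+ k n = begin
    sum (filter H? (upTo (k + n)))
      ≡⟨ cong (sum ∘ filter H?) (applyUpTo-+ id k n) ⟩
    sum (filter H? (upTo k ++ applyUpTo (_+_ k) n))
      ≡⟨ cong sum (filter-++ H? (upTo k) (applyUpTo (_+_ k) n)) ⟩
    sum (filter H? (upTo k) ++ filter H? (applyUpTo (_+_ k) n))
      ≡⟨ sum-++ (filter H? (upTo k)) _ ⟩
    σ k + sum (filter H? (applyUpTo (_+_ k) n)) ∎

  σ-suc : ∀ n → σ (suc n) ≡ σ n + n * length (filter H? [ n ])
  σ-suc n = begin
    σ (suc n)                                   ≡⟨ cong σ (+-comm n 1) ⟨
    σ (n + 1)                                   ≡⟨ σ-+ n 1 ⟩
    σ n + sum (filter H? [ n + 0 ])             ≡⟨ cong (λ k → σ n + sum (filter H? [ k ])) (+-identityʳ n) ⟩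
    σ n + sum (filter H? [ n ])                 ≡⟨ cong (λ w → σ n + w) (sum-filter-[ n ] H?) ⟩
    σ n + n * length (filter H? [ n ])          ∎

  -- The period starting at `i * m` contains the `b` elements of the first one, each raised by
  -- `i * m`. Over all `i < n` these shifts add up to the second term.
  σ-periods : ∀ n → σ (n * m) ≡ n * σ m + b * m * sum (upTo n)
  σ-periods zero    = sym (*-zeroʳ (b * m))
  σ-periods (suc n) = begin
    σ (m + n * m)                                             ≡⟨ cong σ (+-comm m (n * m)) ⟩
    σ (n * m + m)                                             ≡⟨ σ-+ (n * m) m ⟩
    σ (n * m) + sum (filter H? (applyUpTo (_+_ (n * m)) m))      ≡⟨ cong₂ (λ x l → x + sum l) (σ-periods n) (filter-shift n m) ⟩
    n * σ m + b * m * T + sum (map (_+_ (n * m)) (filter H? (upTo m)))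
      ≡⟨ cong (λ w → n * σ m + b * m * T + w) (sum-map-+ (n * m) (filter H? (upTo m))) ⟩
    n * σ m + b * m * T + (σ m + length (filter H? (upTo m)) * (n * m))
      ≡⟨ cong (λ l → n * σ m + b * m * T + (σ m + l * (n * m))) length-residues ⟩
    n * σ m + b * m * T + (σ m + b * (n * m))
      ≡⟨ solve 5 (λ n x b m t → n :* x :+ b :* m :* t :+ (x :+ b :* (n :* m)) := (con 1 :+ n) :* x :+ b :* m :* (t :+ n))
           refl n (σ m) b m T ⟩
    suc n * σ m + b * m * (T + n)                             ≡⟨ cong (λ x → suc n * σ m + b * m * x) (sum-applyUpTo-suc id n) ⟨
    suc n * σ m + b * m * sum (upTo (suc n))                  ∎
    where
    open +-*-Solver
    T = sum (upTo n)

  σ-split : ∀ {k n} → k ≤ n → σ n ≡ σ k + sum (filter H? (applyUpTo (_+_ k) (n ∸ k)))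
  σ-split {k} {n} k≤n = trans (cong σ (sym (m+[n∸m]≡n k≤n))) (σ-+ k (n ∸ k))

  σ-gap : ∀ {k n} → k ≤ n → (∀ {i} → k ≤ i → i < n → ¬ H i) → σ n ≡ σ k
  σ-gap {k} {n} k≤n none = begin
    σ n                                                  ≡⟨ σ-split k≤n ⟩
    σ k + sum (filter H? (applyUpTo (_+_ k) (n ∸ k)))
      ≡⟨ cong (λ l → σ k + sum l) (filter-none H? (applyUpTo⁺₁ (_+_ k) (n ∸ k)
           λ {i} i<n∸k → none (m≤m+n k i) (subst (k + i <_) (m+[n∸m]≡n k≤n) (+-monoʳ-< k i<n∸k)))) ⟩
    σ k + 0                                              ≡⟨ +-identityʳ (σ k) ⟩
    σ k                                                  ∎

  -- This is the weighted sum that `abel-summation` produces for the column starts: the constant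
  -- part `Q` of the increments yields the quadratic term of `S`, the indicator of `H` yields the
  -- correction.
  Q+δ-sum : ∀ Q n → sum (applyUpTo (λ k → k * (length (filter H? [ k ]) + Q)) n) ≡ Q * sum (upTo n) + σ n
  Q+δ-sum Q zero    = sym (trans (+-identityʳ _) (*-zeroʳ Q))
  Q+δ-sum Q (suc n) = begin
    sum (applyUpTo (λ k → k * (δ k + Q)) (suc n))            ≡⟨ sum-applyUpTo-suc (λ k → k * (δ k + Q)) n ⟩
    sum (applyUpTo (λ k → k * (δ k + Q)) n) + n * (δ n + Q)  ≡⟨ cong (_+ n * (δ n + Q)) (Q+δ-sum Q n) ⟩
    Q * T + σ n + n * (δ n + Q)
      ≡⟨ solve 5 (λ q t x n d → q :* t :+ x :+ n :* (d :+ q) := q :* (t :+ n) :+ (x :+ n :* d)) refl Q T (σ n) n (δ n) ⟩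
    Q * (T + n) + (σ n + n * δ n)
      ≡⟨ cong₂ (λ x y → Q * x + y) (sum-applyUpTo-suc id n) (σ-suc n) ⟨
    Q * sum (upTo (suc n)) + σ (suc n)                       ∎
    where
    open +-*-Solver
    T = sum (upTo n)
    δ : ℕ → ℕ
    δ k = length (filter H? [ k ])

-- Column starts of the floor sum, and its expression through `S` and `σ M`.

module FloorSum (s t q N : ℕ) (s<q : s < q) (1≤t : 1 ≤ t) (t<q : t < q) (t∤q : t ∤ q) where
  open Setup s t q N 1≤t t<q t∤q
  open Residue ŝ q̂ t̃ (m%n<n s̄ t̃) (m%n<n q̃ t̃) using (count; count-suc; invariant)
  open ResidueProperties ŝ q̂ t̃ (m%n<n s̄ t̃) (m%n<n q̃ t̃)

  h Q : ℕ
  h = s̄ / t̃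
  Q = q / t

  c : ℕ → ℕ
  c n = count n + n * Q

  c-suc : ∀ n → c (suc n) ≡ c n + (length (filter H? [ n ]) + Q)
  c-suc n = begin
    count (suc n) + (Q + n * Q)                              ≡⟨ cong (_+ (Q + n * Q)) (count-suc n) ⟩
    count n + length (filter H? [ n ]) + (Q + n * Q)
      ≡⟨ solve 4 (λ x d q y → x :+ d :+ (q :+ y) := x :+ y :+ (d :+ q)) refl (count n) (length (filter H? [ n ])) Q (n * Q) ⟩
    c n + (length (filter H? [ n ]) + Q)                     ∎
    where open +-*-Solver

  t̃*g≡t : t̃ * g ≡ t
  t̃*g≡t = m/n*n≡m (gcd[m,n]∣m t q)

  q̃*g≡q : q̃ * g ≡ q
  q̃*g≡q = m/n*n≡m (gcd[m,n]∣n t q)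

  q̃/t̃≡Q : q̃ / t̃ ≡ Q
  q̃/t̃≡Q = begin
    q̃ / t̃               ≡⟨ m*n/o*n≡m/o q̃ g t̃ ⟨
    q̃ * g / (t̃ * g)     ≡⟨ /-congʳ t̃*g≡t ⟩
    q̃ * g / t           ≡⟨ /-congˡ q̃*g≡q ⟩
    q / t               ∎
    where
    instance
      t̃*g≢0 : NonZero (t̃ * g)
      t̃*g≢0 = m*n≢0 t̃ g

  -- `invariant` gives such an equation for the reduced data `ŝ`, `q̂`, `t̃`. Multiplying it by `g`
  -- and restoring the parts of `s` and `q` split off by the divisions yields the one for `s`, `t`,
  -- `q`.
  c-remainder : ∀ n → ∃[ R ] R < t × s + c n * t ≡ R + n * q + h * t
  c-remainder n with invariant n
  ... | r , r<t̃ , eq = s % g + r * g , R<t , (begin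
    s + (count n + n * Q) * t
      ≡⟨ cong₂ (λ x y → x + (count n + n * Q) * y)
           (trans (m≡m%n+[m/n]*n s g) (cong (λ x → s % g + x * g) (m≡m%n+[m/n]*n s̄ t̃))) (sym t̃*g≡t) ⟩
    s % g + (ŝ + h * t̃) * g + (count n + n * Q) * (t̃ * g)
      ≡⟨ solve 8 (λ z x h t g k n Q → z :+ (x :+ h :* t) :* g :+ (k :+ n :* Q) :* (t :* g)
                                  := z :+ (x :+ k :* t) :* g :+ n :* (Q :* t :* g) :+ h :* (t :* g))
           refl (s % g) ŝ h t̃ g (count n) n Q ⟩
    s % g + (ŝ + count n * t̃) * g + n * (Q * t̃ * g) + h * (t̃ * g)
      ≡⟨ cong (λ x → s % g + x * g + n * (Q * t̃ * g) + h * (t̃ * g)) eq ⟩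
    s % g + (r + n * q̂) * g + n * (Q * t̃ * g) + h * (t̃ * g)
      ≡⟨ solve 7 (λ z r g n x y w → z :+ (r :+ n :* x) :* g :+ n :* (y :* g) :+ w
                                  := z :+ r :* g :+ n :* ((x :+ y) :* g) :+ w)
           refl (s % g) r g n q̂ (Q * t̃) (h * (t̃ * g)) ⟩
    s % g + r * g + n * ((q̂ + Q * t̃) * g) + h * (t̃ * g)
      ≡⟨ cong₂ (λ x y → s % g + r * g + n * x + h * y) q≡ t̃*g≡t ⟩
    s % g + r * g + n * q + h * t  ∎)
    where
    open +-*-Solver
    q≡ : (q̂ + Q * t̃) * g ≡ q
    q≡ = begin
      (q̂ + Q * t̃) * g         ≡⟨ cong (λ x → (q̂ + x * t̃) * g) q̃/t̃≡Q ⟨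
      (q̂ + q̃ / t̃ * t̃) * g     ≡⟨ cong (_* g) (m≡m%n+[m/n]*n q̃ t̃) ⟨
      q̃ * g                   ≡⟨ q̃*g≡q ⟩
      q                       ∎
    R<t : s % g + r * g < t
    -- As `s % g < g`, the remainder is below `suc r * g`, and `suc r ≤ t̃`.
    R<t = <-≤-trans (+-monoˡ-< (r * g) (m%n<n s g)) (subst (suc r * g ≤_) t̃*g≡t (*-monoˡ-≤ g r<t̃))

  row : ℕ → ℕ
  row k = (s + k * t) / q

  m≤row⇒mq≤ : ∀ m n → m ≤ row n → m * q ≤ s + n * t
  m≤row⇒mq≤ m n m≤ = ≤-trans (*-monoˡ-≤ q m≤) (m/n*n≤m (s + n * t) q)

  mq≤⇒m≤row : ∀ m n → m * q ≤ s + n * t → m ≤ row n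
  mq≤⇒m≤row m n mq≤ = subst (_≤ row n) (m*n/n≡m m q) (/-monoˡ-≤ q mq≤)

  row⇒c : ∀ m n → m ≤ row n → c m ≤ n + h
  row⇒c m n m≤ = let R , R<t , eq = c-remainder m in
    mq≤s+nt⇒c≤n+h s t R (c m) h (m * q) eq R<t n (m≤row⇒mq≤ m n m≤)

  c⇒row : ∀ m n → c m ≤ n + h → m ≤ row n
  c⇒row m n c≤ = let R , _ , eq = c-remainder m in
    mq≤⇒m≤row m n (c≤n+h⇒mq≤s+nt s t R (c m) h (m * q) eq n c≤)

  row-mono : ∀ n → row n ≤ row (suc n)
  row-mono n = /-monoˡ-≤ q (+-monoʳ-≤ s (m≤n+m (n * t) t))

  -- Holds because `t < q`; hence at most one column starts at each `n`, as `double-counting`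
  -- requires.
  row-step : ∀ n → row (suc n) ≤ suc (row n)
  row-step n = subst (λ x → x / q ≤ suc (row n)) (x∙yz≈y∙xz t s (n * t))
    ([m+n]/o≤1+n/o t (s + n * t) q (<⇒≤ t<q))

  row-0 : row 0 ≡ 0
  row-0 = m<n⇒m/n≡0 (subst (_< q) (sym (+-identityʳ s)) s<q)

  -- `abel-summation` splits `M * c M` into the column starts and the weighted increments;
  -- `double-counting` then combines the column starts with the row sum. Keeping `M * c M` on the
  -- left avoids subtraction.
  S⁺-ℕ : S⁺ s t q N + M * c M ≡ M * (suc N + h) + (Q * sum (upTo M) + σ M)
  S⁺-ℕ = begin
    S⁺ s t q N + M * c M
      ≡⟨ cong₂ (λ l x → sum l + x) (map-upTo row (suc N))
           (sym (abel-summation c (λ k → length (filter H? [ k ]) + Q) c-suc M)) ⟩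
    sum (applyUpTo row (suc N)) + (sum (applyUpTo (c ∘ suc) M) + W)
      ≡⟨ +-assoc (sum (applyUpTo row (suc N))) _ W ⟨
    sum (applyUpTo row (suc N)) + sum (applyUpTo (c ∘ suc) M) + W
      -- `M` is `row N` by definition, so `M` columns are counted.
      ≡⟨ cong₂ _+_ (double-counting row c h row-0 row-mono row-step row⇒c c⇒row N) (Q+δ-sum Q M) ⟩
    M * (suc N + h) + (Q * sum (upTo M) + σ M)  ∎
    where
    W = sum (applyUpTo (λ k → k * (length (filter H? [ k ]) + Q)) M)

  -- `c-remainder M` rearranges to `(c M - h) * t = R + (M * q - s)` with `R < t`, which gives both
  -- bounds needed by `ceiling-/`.
  ceiling-x-M : ceiling x-M ≡ + c M ℤ.- + h
  ceiling-x-M = ceiling-/ i t (+ c M ℤ.- + h)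
    (subst₂ ℤ._<_ lower (solve 2 (λ i t → t :+ (i :- t) := i) refl i (+ t))
      (ℤ.+-monoˡ-< (i ℤ.- + t) (ℤ.+<+ R<t)))
    (subst (i ℤ.≤_) (sym scaled) (ℤ.i≤j+i i (+ R)))
    where
    open ℤ-Solver
    i = + (M * q) ℤ.- + s
    R = proj₁ (c-remainder M)
    R<t = proj₁ (proj₂ (c-remainder M))
    eq = proj₂ (proj₂ (c-remainder M))
    scaled : (+ c M ℤ.- + h) ℤ.* + t ≡ + R ℤ.+ i
    scaled = begin
      (+ c M ℤ.- + h) ℤ.* + t
        ≡⟨ solve 4 (λ c h t s → (c :- h) :* t := s :+ c :* t :- s :- h :* t) refl (+ c M) (+ h) (+ t) (+ s) ⟩
      + s ℤ.+ + c M ℤ.* + t ℤ.- + s ℤ.- + h ℤ.* + t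
        ≡⟨ cong₂ (λ x y → + s ℤ.+ x ℤ.- + s ℤ.- y) (ℤ.pos-* (c M) t) (ℤ.pos-* h t) ⟨
      + (s + c M * t) ℤ.- + s ℤ.- + (h * t)
        ≡⟨ cong (λ x → + x ℤ.- + s ℤ.- + (h * t)) eq ⟩
      + R ℤ.+ + (M * q) ℤ.+ + (h * t) ℤ.- + s ℤ.- + (h * t)
        ≡⟨ solve 4 (λ r m x s → r :+ m :+ x :- s :- x := r :+ (m :- s)) refl (+ R) (+ (M * q)) (+ (h * t)) (+ s) ⟩
      + R ℤ.+ i  ∎
    lower : + R ℤ.+ (i ℤ.- + t) ≡ ℤ.pred (+ c M ℤ.- + h) ℤ.* + t
    lower = begin
      + R ℤ.+ (i ℤ.- + t)
        ≡⟨ ℤ.+-assoc (+ R) i (ℤ.- + t) ⟨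
      + R ℤ.+ i ℤ.- + t
        ≡⟨ cong (ℤ._- + t) scaled ⟨
      (+ c M ℤ.- + h) ℤ.* + t ℤ.- + t
        ≡⟨ solve 2 (λ x t → x :* t :- t := (con ℤ.-1ℤ :+ x) :* t) refl (+ c M ℤ.- + h) (+ t) ⟩
      ℤ.pred (+ c M ℤ.- + h) ℤ.* + t  ∎

  -- Once `c M - h` is recognised as `ceiling x-M`, the factor `N + 1 + h - c M` coming from `S⁺-ℕ`
  -- is the second factor of the linear term of `S`.
  S⁺≡S+σ : + S⁺ s t q N ≡ S ℤ.+ + σ M
  S⁺≡S+σ = begin
    + S⁺ s t q N
      ≡⟨ solve 2 (λ x y → x := x :+ y :- y) refl (+ S⁺ s t q N) (+ M ℤ.* + c M) ⟩
    + S⁺ s t q N ℤ.+ + M ℤ.* + c M ℤ.- + M ℤ.* + c M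
      ≡⟨ cong (λ x → + S⁺ s t q N ℤ.+ x ℤ.- + M ℤ.* + c M) (ℤ.pos-* M (c M)) ⟨
    + (S⁺ s t q N + M * c M) ℤ.- + M ℤ.* + c M
      ≡⟨ cong (λ x → + x ℤ.- + M ℤ.* + c M) S⁺-ℕ ⟩
    + (M * (suc N + h)) ℤ.+ (+ (Q * T) ℤ.+ + σ M) ℤ.- + M ℤ.* + c M
      ≡⟨ cong₂ (λ x y → x ℤ.+ (y ℤ.+ + σ M) ℤ.- + M ℤ.* + c M) (ℤ.pos-* M (suc N + h)) (ℤ.pos-* Q T) ⟩
    + M ℤ.* (+ 1 ℤ.+ + N ℤ.+ + h) ℤ.+ (+ Q ℤ.* + T ℤ.+ + σ M) ℤ.- + M ℤ.* + c M
      ≡⟨ solve 7 (λ m n h q t x c → m :* (con (+ 1) :+ n :+ h) :+ (q :* t :+ x) :- m :* c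
                                  := q :* t :+ m :* (n :- (c :- h) :+ con (+ 1)) :+ x)
           refl (+ M) (+ N) (+ h) (+ Q) (+ T) (+ σ M) (+ c M) ⟩
    + Q ℤ.* + T ℤ.+ + M ℤ.* (+ N ℤ.- (+ c M ℤ.- + h) ℤ.+ + 1) ℤ.+ + σ M
      ≡⟨ cong₂ (λ x y → + Q ℤ.* x ℤ.+ + M ℤ.* (+ N ℤ.- y ℤ.+ + 1) ℤ.+ + σ M) ([n[n-1]]/2≡sum-upTo M) ceiling-x-M ⟨
    S ℤ.+ + σ M  ∎
    where
    open ℤ-Solver
    T = sum (upTo M)

  -- The extreme elements of `J`.

  J-sorted : Sorted J
  J-sorted = Sorted.filter⁺ ≤-totalOrder H? (Sorted.applyUpTo⁺₂ ≤-totalOrder id t̃ n≤1+n)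

  lookup-mono : ∀ i k → toℕ i ≤ toℕ k → lookup J i ≤ lookup J k
  lookup-mono i k = Sorted.lookup-mono-≤ ≤-totalOrder J-sorted {i} {k}

  lookup-J : ∀ {k} → k < t̃ → H k → ∃[ i ] k ≡ lookup J i
  lookup-J k<t̃ Hk = _ , lookup-index (∈-filter⁺ H? (∈-upTo⁺ k<t̃) Hk)

  j<t̃ : ∀ i → j i < t̃
  j<t̃ i = ∈-upTo⁻ (proj₁ (∈-filter⁻ H? {xs = upTo t̃} (∈-lookup (cast (sym length-residues) i))))

  -- This bounds all of `H`, not only `J`: below `t̃` the sortedness of `J` puts index 0 lowest, and
  -- from `t̃` on every entry of `J` is smaller anyway.
  j-first-≤ : ∀ {k} → H k → j-first ≤ k
  j-first-≤ {k} Hk = [ below , ≤-trans (<⇒≤ (j<t̃ _)) ]′ (<-≤-connex k t̃)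
    where
    below : k < t̃ → j-first ≤ k
    below k<t̃ = let i , k≡ = lookup-J k<t̃ Hk in
      subst (j-first ≤_) (sym k≡) (lookup-mono _ i (≤-trans (≤-reflexive
        (trans (toℕ-cast (sym length-residues) _) (toℕ-fromℕ< 1≤q̂))) z≤n))

  ≤-j-last : ∀ {k} → k < t̃ → H k → k ≤ j-last
  ≤-j-last k<t̃ Hk = let i , k≡ = lookup-J k<t̃ Hk in
    -- `J` has length `q̂`, so no index exceeds `q̂ ∸ 1`, the index of `j-last`.
    subst (_≤ j-last) (sym k≡) (lookup-mono i _ (subst (toℕ i ≤_)
      (sym (trans (toℕ-cast (sym length-residues) _) (toℕ-fromℕ< _)))
      (<⇒≤pred (subst (toℕ i <_) length-residues (toℕ<n i)))))

  -- Evaluation of `σ M` in the separate cases.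

  case-a : j-first ≥ M → σ M ≡ 0
  case-a M≤j = σ-gap z≤n λ _ i<M Hi → <⇒≱ (<-≤-trans i<M M≤j) (j-first-≤ Hi)

  -- The elements of `H` nearest to `t̃` on its two sides are `j-last` and `j-first + t̃`. Neither
  -- lies in the stretch between `M` and `t̃`, in whichever order these come, so the partial sums
  -- agree.
  case-b2 : j-last < M → j-first + t̃ ≥ M → σ M ≡ σ t̃
  case-b2 j<M M≤j+t̃ = [ short , long ]′ (≤-total M t̃)
    where
    short : M ≤ t̃ → σ M ≡ σ t̃
    short M≤t̃ = sym (σ-gap M≤t̃ λ M≤i i<t̃ Hi → <⇒≱ (<-≤-trans j<M M≤i) (≤-j-last i<t̃ Hi))
    H-∸ : ∀ {i} → t̃ ≤ i → H i → H (i ∸ t̃)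
    H-∸ {i} t̃≤i Hi = subst (_< q̂) (H-periodic 1 (i ∸ t̃))
      (subst H (sym (trans (cong (_+ (i ∸ t̃)) (*-identityˡ t̃)) (m+[n∸m]≡n t̃≤i))) Hi)
    long : t̃ ≤ M → σ M ≡ σ t̃
    long t̃≤M = σ-gap t̃≤M λ {i} t̃≤i i<M Hi → <⇒≱ i<M
      (≤-trans M≤j+t̃ (subst (j-first + t̃ ≤_) (m∸n+n≡m t̃≤i) (+-monoˡ-≤ t̃ (j-first-≤ (H-∸ t̃≤i Hi)))))

  -- Splitting at `u * t̃` leaves `u` whole periods for `σ-periods`. As `u` is computed from
  -- `M ∸ 1`, a positive multiple `M` of `t̃` leaves its last full period in the final sum.
  case-b3 : + σ M ≡ + u ℤ.* + sum J ℤ.+ + q̂ ℤ.* + t̃ ℤ.* (((+ u ℤ.- + 1) ℤ.* + u) /ℕ 2)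
                              ℤ.+ + sum H∩[ u * t̃ , M ⟩
  case-b3 = begin
    + σ M                                                  ≡⟨ cong +_ (σ-split ut̃≤M) ⟩
    + σ (u * t̃) ℤ.+ + K                                    ≡⟨ cong (λ x → + x ℤ.+ + K) (σ-periods u) ⟩
    + (u * sum J) ℤ.+ + (q̂ * t̃ * sum (upTo u)) ℤ.+ + K
      ≡⟨ cong₂ (λ x y → x ℤ.+ y ℤ.+ + K) (ℤ.pos-* u (sum J)) (trans (ℤ.pos-* (q̂ * t̃) (sum (upTo u)))
           (cong₂ ℤ._*_ (ℤ.pos-* q̂ t̃) (sym (trans (cong (_/ℕ 2) (ℤ.*-comm (+ u ℤ.- + 1) (+ u))) ([n[n-1]]/2≡sum-upTo u))))) ⟩
    + u ℤ.* + sum J ℤ.+ + q̂ ℤ.* + t̃ ℤ.* (((+ u ℤ.- + 1) ℤ.* + u) /ℕ 2) ℤ.+ + K  ∎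
    where
    K = sum H∩[ u * t̃ , M ⟩
    ut̃≤M : u * t̃ ≤ M
    -- For `M = 0` the truncated `M ∸ 1` gives `u = 0`, so the bound covers this value too.
    ut̃≤M = ≤-trans (m/n*n≤m (M ∸ 1) t̃) (m∸n≤m M 1)

  S⁺-a : j-first ≥ M → + S⁺ s t q N ≡ S
  S⁺-a M≤j = trans S⁺≡S+σ (trans (cong (λ x → S ℤ.+ + x) (case-a M≤j)) (ℤ.+-identityʳ S))

  S⁺-b2 : j-last < M → j-first + t̃ ≥ M → + S⁺ s t q N ≡ S ℤ.+ + sum J
  S⁺-b2 j<M M≤j+t̃ = trans S⁺≡S+σ (cong (λ x → S ℤ.+ + x) (case-b2 j<M M≤j+t̃))

  S⁺-b3 : + S⁺ s t q N ≡ S ℤ.+ + u ℤ.* + sum J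
                        ℤ.+ + q̂ ℤ.* + t̃ ℤ.* (((+ u ℤ.- + 1) ℤ.* + u) /ℕ 2)
                        ℤ.+ + sum H∩[ u * t̃ , M ⟩
  S⁺-b3 = begin
    + S⁺ s t q N             ≡⟨ S⁺≡S+σ ⟩
    S ℤ.+ + σ M              ≡⟨ cong (λ x → S ℤ.+ x) case-b3 ⟩
    S ℤ.+ (a ℤ.+ b ℤ.+ k)    ≡⟨ ℤ.+-assoc S (a ℤ.+ b) k ⟨
    S ℤ.+ (a ℤ.+ b) ℤ.+ k    ≡⟨ cong (ℤ._+ k) (ℤ.+-assoc S a b) ⟨
    S ℤ.+ a ℤ.+ b ℤ.+ k      ∎
    where
    a = + u ℤ.* + sum J
    b = + q̂ ℤ.* + t̃ ℤ.* (((+ u ℤ.- + 1) ℤ.* + u) /ℕ 2)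
    k = + sum H∩[ u * t̃ , M ⟩

theorem10 : (s t q N : ℕ) (s<q : s < q) (1≤t : 1 ≤ t) (t<q : t < q)
  (t∤q : t ∤ q) (g>1 : gcd t q > 1) →
  let open Setup s t q N 1≤t t<q t∤q in
  (j-first ≥ M → + S⁺ s t q N ≡ S)
  × (j-first < M → M ≤ j-last →
     + S⁺ s t q N ≡ S ℤ.+ + sum H∩[ 0 , M ⟩)
  × (j-last < M → j-first + t̃ ≥ M →
     + S⁺ s t q N ≡ S ℤ.+ + sum J)
  × (j-last < M → j-first + t̃ < M →
     + S⁺ s t q N ≡ S ℤ.+ + u ℤ.* + sum J
                      ℤ.+ + q̂ ℤ.* + t̃ ℤ.* (((+ u ℤ.- + 1) ℤ.* + u) /ℕ 2)
                      ℤ.+ + sum H∩[ u * t̃ , M ⟩)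
theorem10 s t q N s<q 1≤t t<q t∤q g>1 =
  -- `sum H∩[ 0 , M ⟩` computes to `σ M`, so the second case is `S⁺≡S+σ` itself.
  S⁺-a , (λ _ _ → S⁺≡S+σ) , S⁺-b2 , (λ _ _ → S⁺-b3)
  where open FloorSum s t q N s<q 1≤t t<q t∤q
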